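{- Let $\mathcal{H}$ be the class of connected graphs $H$ that contain an edge $\{u,v\}$ such that every cycle of $H$ contains at least one of $u$ and $v$. Then every connected graph on $5$ vertices other than the $5$-clique $K_5$ belongs to $\mathcal{H}$.
   Context: All graphs are finite, simple and undirected. -}

module Defs where

open import Data.Fin.Base using (Fin)
open import Data.Fin.Properties using (_≟_)
open import Data.List.Base using (List; _∷_; _∷ʳ_; length)
open import Data.List.Membership.Propositional using (_∈_)
open import Data.List.Relation.Unary.Linked using (Linked)
open import Data.List.Relation.Unary.Unique.Propositional using (Unique)
open import Data.Nat.Base using (ℕ; _≤_)
open import Data.Product.Base using (_×_; ∃₂)
open import Data.Sum.Base using (_⊎_)
open import Function.Base using (_∘_)
open import Function.Bundles using (_↔_; _⇔_; module Inverse)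
open import Function.Construct.Identity using (↔-id)
open import Relation.Binary.Construct.Closure.ReflexiveTransitive using (Star)
open import Relation.Binary.Definitions using (Decidable; Irreflexive; Symmetric)
open import Relation.Binary.PropositionalEquality.Core using (_≡_; _≢_; sym)
open import Relation.Nullary.Decidable.Core using (¬?)

-- Adjacency is required to be decidable, which holds classically for every
-- relation.
record Graph : Set₁ where
  infix 4 _~_ _~?_
  field
    V       : Set
    order   : ℕ
    finite  : V ↔ Fin order
    _~_     : V → V → Set
    _~?_    : Decidable _~_
    ~-irrefl : Irreflexive _≡_ _~_
    ~-sym    : Symmetric _~_

record _≅_ (G H : Graph) : Set where
  private
    module G = Graph G
    module H = Graph H
  field
    bijection : G.V ↔ H.V
  open Inverse bijection public using (to)
  field
    adjacency : ∀ x y → (x G.~ y) ⇔ (to x H.~ to y)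

infix 4 _≅_

K : ℕ → Graph
K n = record
  { V        = Fin n
  ; order    = n
  ; finite   = ↔-id (Fin n)
  ; _~_      = _≢_
  ; _~?_     = λ i j → ¬? (i ≟ j)
  ; ~-irrefl = λ i≡j i≢j → i≢j i≡j
  ; ~-sym    = λ i≢j → i≢j ∘ sym
  }

-- Star _~_ x y is the type of walks from x to y.
Connected : Graph → Set
Connected G = ∀ x y → Star _~_ x y
  where open Graph G

-- A cycle v₁ v₂ … vₖ (k ≥ 3, the vᵢ distinct) is presented with a chosen
-- starting vertex and orientation; `closed` says v₁ ~ v₂ ~ … ~ vₖ ~ v₁.
record Cycle (G : Graph) : Set where
  open Graph G
  field
    start : V
    rest  : List V

  vertices : List V
  vertices = start ∷ rest

  field
    long     : 3 ≤ length vertices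
    distinct : Unique vertices
    closed   : Linked _~_ (vertices ∷ʳ start)

ℋ : Graph → Set
ℋ H = Connected H
    × ∃₂ λ u v → u ~ v
               × ((C : Cycle H) → u ∈ Cycle.vertices C ⊎ v ∈ Cycle.vertices C)
  where open Graph H

{-# OPTIONS --safe #-}
-- Deleting the ends of an edge uv leaves three vertices, and a cycle avoiding
-- u and v is a triangle on them; so uv is a good edge as soon as two of the
-- remaining vertices are non-adjacent.  Let a, b be non-adjacent, let c be a
-- neighbour of a, and let d, e be the other two vertices.  If d ~ e, the edge
-- de is good because a ≁ b; otherwise the edge ac is good because d ≁ e.
module Submission where

open import Defs
open import Data.Fin.Base using (zero; suc)
open import Data.Fin.Properties as Fin using (¬∀⟶∃¬; injective⇒≤)
open import Data.List.Base using (List; []; _∷_; length; lookup)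
open import Data.List.Membership.DecPropositional as DecMembership using ()
open import Data.List.Membership.Propositional using (_∈_; _∉_)
open import Data.List.Membership.Propositional.Properties using (∈-lookup)
open import Data.List.Membership.Setoid.Properties using (index-injective)
open import Data.List.Relation.Unary.All as All using ([]; _∷_)
open import Data.List.Relation.Unary.All.Properties using (¬Any⇒All¬)
open import Data.List.Relation.Unary.AllPairs using ([]; _∷_)
open import Data.List.Relation.Unary.Any using (here; there; index)
open import Data.List.Relation.Unary.Linked using (_∷_)
open import Data.List.Relation.Unary.Unique.Propositional using (Unique)
open import Data.Nat.Base using (_≤_; _<_; s≤s)
open import Data.Nat.Properties using (<⇒≱; ≤-refl; m≤n+m)
open import Data.Product.Base using (∃; ∃₂; _×_; _,_)
open import Data.Sum.Base using (_⊎_; inj₁; inj₂)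
open import Function.Base using (_∘_)
open import Function.Bundles using (mk⇔; module Inverse; module Injection)
open import Function.Properties.Inverse using (↔⇒↣; ↔-sym)
open import Relation.Binary.Construct.Closure.ReflexiveTransitive using (Star; ε; _◅_)
open import Relation.Binary.Definitions using (DecidableEquality)
open import Relation.Binary.PropositionalEquality.Core using (_≡_; _≢_; refl; sym; cong; subst; ≢-sym)
open import Relation.Binary.PropositionalEquality.Properties using (setoid)
open import Relation.Nullary.Decidable using (Dec; yes; no; ¬?; _→-dec_; via-injection)
open import Relation.Nullary.Negation.Core using (¬_; contradiction)

lookup-injective : ∀ {A : Set} {xs : List A} → Unique xs →
  ∀ i j → lookup xs i ≡ lookup xs j → i ≡ j
lookup-injective (_  ∷ _)   zero    zero    _  = refl
lookup-injective (x∉ ∷ _)   zero    (suc j) eq = contradiction eq (All.lookup x∉ (∈-lookup j))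
lookup-injective (x∉ ∷ _)   (suc i) zero    eq = contradiction (sym eq) (All.lookup x∉ (∈-lookup i))
lookup-injective (_  ∷ xs!) (suc i) (suc j) eq = cong suc (lookup-injective xs! i j eq)

module _ (G : Graph) where
  open Graph G
  open Inverse finite using (to; from; strictlyInverseʳ)

  private
    to-injective : ∀ {x y} → to x ≡ to y → x ≡ y
    to-injective = Injection.injective (↔⇒↣ finite)

    from-injective : ∀ {i j} → from i ≡ from j → i ≡ j
    from-injective = Injection.injective (↔⇒↣ (↔-sym finite))

  _≟ᵥ_ : DecidableEquality V
  _≟ᵥ_ = via-injection (↔⇒↣ finite) Fin._≟_

  _∈?_ : ∀ x xs → Dec (x ∈ xs)
  _∈?_ = DecMembership._∈?_ _≟ᵥ_

  -- Pigeonhole: if every vertex occurred in `xs`, sending each to a position where it occurs would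
  -- be injective, since a position determines its entry, and `order` would be at most `length xs`.
  ∃-fresh : ∀ xs → length xs < order → ∃ λ x → x ∉ xs
  ∃-fresh xs short
    with i , i∉xs ← ¬∀⟶∃¬ order (λ i → from i ∈ xs) (λ i → from i ∈? xs)
           (λ from∈xs → <⇒≱ short (injective⇒≤ {f = index ∘ from∈xs}
             (from-injective ∘ index-injective (setoid V) (from∈xs _) (from∈xs _))))
    = from i , i∉xs

  Unique⇒length≤order : ∀ {xs} → Unique xs → length xs ≤ order
  Unique⇒length≤order {xs} xs! =
    injective⇒≤ {f = to ∘ lookup xs} (lookup-injective xs! _ _ ∘ to-injective)

  -- A missing vertex could be prepended to `xs`, giving distinct vertices in number greater than
  -- `order`.
  Unique⇒complete : ∀ {xs} → Unique xs → order ≤ length xs → ∀ x → x ∈ xs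
  Unique⇒complete {xs} xs! order≤ x with x ∈? xs
  ... | yes x∈xs = x∈xs
  ... | no  x∉xs = contradiction order≤
    (<⇒≱ (Unique⇒length≤order (¬Any⇒All¬ xs x∉xs ∷ xs!)))

  complete⇒≅K : (∀ x y → x ≢ y → x ~ y) → G ≅ K order
  complete⇒≅K complete = record
    { bijection = finite
    ; adjacency = λ x y → mk⇔
        (λ x~y tx≡ty → ~-irrefl (to-injective tx≡ty) x~y)
        (λ tx≢ty → complete x y λ { refl → tx≢ty refl })
    }

  private
    -- The guard makes this vacuous on the diagonal, so its failure at a pair gives distinctness and
    -- non-adjacency at once.
    Adjacent : V → V → Set
    Adjacent x y = x ≢ y → x ~ y

    adjacent? : ∀ i j → Dec (Adjacent (from i) (from j))
    adjacent? i j = ¬? (from i ≟ᵥ from j) →-dec (from i ~? from j)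

    Adjacent-from∘to : ∀ {x y} → Adjacent (from (to x)) (from (to y)) → Adjacent x y
    Adjacent-from∘to {x} {y} rewrite strictlyInverseʳ x | strictlyInverseʳ y = λ p → p

  -- Completeness is decidable by a search over indices in `Fin order`, so its failure yields a
  -- witness: first an index whose row fails, then a second index within that row.
  ∃-nonadjacent : ¬ (G ≅ K order) → ∃₂ λ a b → a ≢ b × ¬ a ~ b
  ∃-nonadjacent G≇K
    with i , ¬Pi ← ¬∀⟶∃¬ order _ (λ i → Fin.all? (adjacent? i))
           (λ complete → G≇K (complete⇒≅K λ x y →
             Adjacent-from∘to (complete (to x) (to y))))
    with j , ¬Pij ← ¬∀⟶∃¬ order _ (adjacent? i) ¬Pi
    = from i , from j
    , (λ eq → ¬Pij λ ne → contradiction eq ne)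
    , (λ adj → ¬Pij λ _ → adj)

  -- A walk between distinct ends is nonempty, and its first step leads to a neighbour.
  ∃-neighbour : ∀ {a b} → a ≢ b → Star _~_ a b → ∃ (a ~_)
  ∃-neighbour a≢b ε         = contradiction refl a≢b
  ∃-neighbour a≢b (a~c ◅ _) = _ , a~c

  -- With `long`, the cycle has exactly three vertices, and any two of them are consecutive once the
  -- closing edge is counted.
  triangle-adjacent : (C : Cycle G) → length (Cycle.vertices C) ≤ 3 →
    ∀ {p q} → p ∈ Cycle.vertices C → q ∈ Cycle.vertices C → p ≢ q → p ~ q
  triangle-adjacent
    record { rest = y ∷ z ∷ [] ; closed = x~y ∷ y~z ∷ z~x ∷ _ } _ p∈ q∈ p≢q
    with p∈ | q∈
  ... | here refl                 | here refl                 = contradiction refl p≢q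
  ... | here refl                 | there (here refl)         = x~y
  ... | here refl                 | there (there (here refl)) = ~-sym z~x
  ... | there (here refl)         | here refl                 = ~-sym x~y
  ... | there (here refl)         | there (here refl)         = contradiction refl p≢q
  ... | there (here refl)         | there (there (here refl)) = y~z
  ... | there (there (here refl)) | here refl                 = z~x
  ... | there (there (here refl)) | there (here refl)         = ~-sym y~z
  ... | there (there (here refl)) | there (there (here refl)) = contradiction refl p≢q
  triangle-adjacent record { rest = [] ; long = s≤s () }
  triangle-adjacent record { rest = _ ∷ [] ; long = s≤s (s≤s ()) }
  triangle-adjacent record { rest = _ ∷ _ ∷ _ ∷ _ } (s≤s (s≤s (s≤s ())))

  edge-meets-cycles : order ≡ 5 → ∀ {u v p q} → Unique (u ∷ v ∷ p ∷ q ∷ []) →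
    ¬ p ~ q → (C : Cycle G) → u ∈ Cycle.vertices C ⊎ v ∈ Cycle.vertices C
  edge-meets-cycles order≡5 {u} {v} {p} {q}
    ((u≢v ∷ u≢p ∷ u≢q ∷ []) ∷ (v≢p ∷ v≢q ∷ []) ∷ (p≢q ∷ []) ∷ _) p≁q C
    with u ∈? Cycle.vertices C | v ∈? Cycle.vertices C
  ... | yes u∈C | _       = inj₁ u∈C
  ... | no _    | yes v∈C = inj₂ v∈C
  ... | no u∉C  | no v∉C  = contradiction
    (triangle-adjacent C C≤3 (on-C u≢p v≢p) (on-C u≢q v≢q) p≢q) p≁q
    where
    open Cycle C

    -- This list is counted in both directions. It has at most 5 entries, so `C` has at most 3; by
    -- `long` it has at least 5, so it exhausts the graph and every vertex other than `u` and `v`,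
    -- in particular `p` and `q`, lies on `C`.
    uvC! : Unique (u ∷ v ∷ vertices)
    uvC! = (u≢v ∷ ¬Any⇒All¬ vertices u∉C) ∷ ¬Any⇒All¬ vertices v∉C ∷ distinct

    C≤3 : length vertices ≤ 3
    C≤3 with s≤s (s≤s le) ← subst (length (u ∷ v ∷ vertices) ≤_) order≡5
                                  (Unique⇒length≤order uvC!) = le

    on-C : ∀ {x} → u ≢ x → v ≢ x → x ∈ vertices
    on-C {x} u≢x v≢x
      with Unique⇒complete uvC! (subst (_≤ length (u ∷ v ∷ vertices)) (sym order≡5)
                                       (s≤s (s≤s long))) x
    ... | here x≡u          = contradiction (sym x≡u) u≢x
    ... | there (here x≡v)  = contradiction (sym x≡v) v≢x
    ... | there (there x∈C) = x∈C

mainTheorem4 : (G : Graph) → Graph.order G ≡ 5 → Connected G → ¬ (G ≅ K 5) → ℋ G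
mainTheorem4 G order≡5 connected G≇K₅
  with a , b , a≢b , a≁b ← ∃-nonadjacent G (G≇K₅ ∘ subst (λ n → G ≅ K n) order≡5)
  with c , a~c ← ∃-neighbour G a≢b (connected a b)
  -- The bound here is 4 ≤ 1 + 4; listing `d` as well makes the next one 5 ≤ 5, the last for which a
  -- fresh vertex exists.
  with d , d∉ ← ∃-fresh G (a ∷ b ∷ c ∷ [])
         (subst (3 <_) (sym order≡5) (m≤n+m 4 1))
  with e , e∉ ← ∃-fresh G (d ∷ a ∷ b ∷ c ∷ [])
         (subst (4 <_) (sym order≡5) ≤-refl)
  with d≢a ∷ d≢b ∷ d≢c ∷ [] ← ¬Any⇒All¬ _ d∉
  with e≢d ∷ e≢a ∷ e≢b ∷ e≢c ∷ [] ← ¬Any⇒All¬ _ e∉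
  with Graph._~?_ G d e
... | yes d~e = connected , d , e , d~e , edge-meets-cycles G order≡5
  ((≢-sym e≢d ∷ d≢a ∷ d≢b ∷ []) ∷ (e≢a ∷ e≢b ∷ []) ∷ (a≢b ∷ []) ∷ [] ∷ []) a≁b
-- Now `d` and `e` are the non-adjacent pair off the edge; `a` differs from its neighbour `c` by
-- irreflexivity, and the other inequalities come from freshness.
... | no d≁e = connected , a , c , a~c , edge-meets-cycles G order≡5
  ((a≢c ∷ ≢-sym d≢a ∷ ≢-sym e≢a ∷ []) ∷ (≢-sym d≢c ∷ ≢-sym e≢c ∷ [])
    ∷ (≢-sym e≢d ∷ []) ∷ [] ∷ []) d≁e
  where
  a≢c : a ≢ c
  a≢c a≡c = Graph.~-irrefl G a≡c a~c
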